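{- Let $k$ be a positive even integer and let $L$ be the set of all odd integers. Suppose that $\mathcal{F}$ is a finite family of $k$-element sets that contains no $L$-clique of size $m$. Then the associated graph $G_{\mathcal{F}}$ has fractional chromatic number at most $O_k(m^{k/2})$.
   Context: Sets $F_1,\dots,F_t$ form an $L$-clique of size $t$ if $|F_i\cap F_j|\in L$ for all $i<j$. The graph $G_{\mathcal F}$ has vertex set $\mathcal F$, with distinct $F,F'$ adjacent iff $|F\cap F'|\in L$. A fractional colouring of size $s\ge1$ of a graph $G$ is a probability distribution on independent sets of $G$ such that each vertex lies in a random independent set drawn from it with probability at least $1/s$; the fractional chromatic number is the least such $s$. $O_k$ hides a multiplicative constant depending only on $k$. -}

module Defs where

open import Data.Nat using (ℕ; _%_)
open import Data.Fin using (Fin; _<_)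
open import Data.Fin.Subset using (Subset; _∩_; ∣_∣)
open import Data.Bool using (if_then_else_; true)
open import Relation.Nullary using (¬_)
open import Data.List.Relation.Unary.All using (All)
import Data.Vec as Vec
open import Data.List using (List; foldr; length; lookup)
open import Data.List.Membership.Propositional using (_∈_)
open import Data.List.Relation.Unary.Unique.Propositional using (Unique)
open import Data.Product using (_×_; _,_; Σ; proj₁; proj₂)
open import Data.Rational using (ℚ; 0ℚ; 1ℚ; _+_; _*_; _≤_)
open import Relation.Binary.PropositionalEquality using (_≡_; _≢_)
open import Function.Definitions using (Injective)

Odd : ℕ → Set
Odd x = x % 2 ≡ 1

record Family (n k : ℕ) : Set where
  field
    sets    : List (Subset n)
    unique  : Unique sets
    uniform : ∀ {A} → A ∈ sets → ∣ A ∣ ≡ k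

  Vertex : Set
  Vertex = Fin (length sets)

  member : Vertex → Subset n
  member = lookup sets

  -- adjacency in G_𝓕 (for distinct vertices): |F ∩ F'| ∈ L
  Adj : Vertex → Vertex → Set
  Adj u v = Odd ∣ member u ∩ member v ∣

open Family public

HasLClique : ∀ {n k} → Family n k → ℕ → Set
HasLClique 𝓕 t =
  Σ (Fin t → Vertex 𝓕) λ f →
    Injective _≡_ _≡_ f × (∀ i j → i < j → Adj 𝓕 (f i) (f j))

IsIndependent : ∀ {n k} (𝓕 : Family n k) → Subset (length (sets 𝓕)) → Set
IsIndependent 𝓕 I = ∀ u v → u ≢ v →
  Vec.lookup I u ≡ true → Vec.lookup I v ≡ true → ¬ Adj 𝓕 u v

-- A finitely supported probability distribution on independent sets:
-- a list of (weight, independent set) pairs.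
WeightedSets : ℕ → Set
WeightedSets N = List (ℚ × Subset N)

totalWeight : ∀ {N} → WeightedSets N → ℚ
totalWeight = foldr (λ p acc → proj₁ p + acc) 0ℚ

massAt : ∀ {N} → WeightedSets N → Fin N → ℚ
massAt ws v = foldr (λ p acc → (if Vec.lookup (proj₂ p) v then proj₁ p else 0ℚ) + acc) 0ℚ ws

-- A fractional colouring of size s ≥ 1 of G_𝓕.  The condition
-- "each vertex lies in the random set with probability ≥ 1/s" is written
-- as 1 ≤ s · P(v ∈ I), which is equivalent since s > 0.
record FractionalColouring {n k} (𝓕 : Family n k) (s : ℚ) : Set where
  field
    size≥1      : 1ℚ ≤ s
    dist        : WeightedSets (length (sets 𝓕))
    nonneg      : All (λ p → 0ℚ ≤ proj₁ p) dist
    independent : All (λ p → IsIndependent 𝓕 (proj₂ p)) dist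
    sums-to-1   : totalWeight dist ≡ 1ℚ
    covers      : ∀ v → 1ℚ ≤ s * massAt dist v

FracChromaticAtMost : ∀ {n k} → Family n k → ℚ → Set
FracChromaticAtMost 𝓕 s = Σ ℚ λ s' → s' ≤ s × FractionalColouring 𝓕 s'

{-# OPTIONS --safe #-}

-- Induction on k / 2, removing a pair of points from every set. Fix a point v. A maximal
-- sunflower with kernel {v} is a clique, so its petals cover a set U v of O(m) points other than
-- v, and every member containing v meets U v. The digraph v → u ∈ U v has outdegree O(m), so the
-- points can be ordered with O(m) in-edges to each point from later ones. The edges pointing
-- backwards form a graph of degree O(m), and every member A contains one of them: follow an
-- out-edge within A from the last point of A. Colour these edges properly with O(m) colours. For
-- a random colour c and a random set S of points, keep the members A for which A ∩ S is an edge
-- of colour c; each member is kept with probability at least 2⁻ᵏ / O(m). Edges of one colour meet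
-- in 0 or 2 points, so on the kept members A ↦ A ─ S preserves all parities of intersections, and
-- these (k - 2)-sets again contain no clique of size m.
module Submission where

open import Defs
open import Algebra.Properties.CommutativeSemigroup using (interchange)
open import Data.Bool using (Bool; true; false; _∧_)
import Data.Bool as Bool
open import Data.Fin using (Fin)
import Data.Fin as Fin
import Data.Fin.Properties as Fin
open import Data.Fin.Subset
  using (Subset; inside; outside; _∈_; _∉_; _⊆_; _∩_; _∪_; _─_; _-_; ⋃; ⁅_⁆; ∣_∣; Nonempty; Empty)
open import Data.Fin.Subset.Properties
import Data.Integer as ℤ
import Data.Integer.Properties as ℤ
open import Data.List using (List; []; _∷_; _++_; map; length; concatMap; filter; allFin)
import Data.List as List
open import Data.List.Membership.Propositional as List using (find; lose)
import Data.List.Membership.DecPropositional as DecMembership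
open import Data.List.Membership.Propositional.Properties
  using (∈-map⁺; ∈-map⁻; ∈-filter⁺; ∈-filter⁻; ∈-++⁺ˡ; ∈-++⁺ʳ; ∈-++⁻; ∈-∃++; ∈-allFin;
    ∈-lookup)
open import Data.List.Properties using (map-++; map-∘; length-map; length-++; length-tabulate)
open import Data.List.Relation.Binary.Permutation.Propositional
  using (_↭_; ↭-refl; ↭-sym; ↭-trans; ↭-prep; ↭⇒↭ₛ)
import Data.List.Relation.Binary.Permutation.Propositional.Properties as ↭
import Data.List.Relation.Binary.Permutation.Setoid.Properties as ↭ₛ
open import Data.List.Relation.Unary.All as All using (All; []; _∷_)
import Data.List.Relation.Unary.All.Properties as All
open import Data.List.Relation.Unary.AllPairs as AllPairs using (AllPairs; []; _∷_)
open import Data.List.Relation.Unary.Any as Any using (Any; here; there; any?; index)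
open import Data.List.Relation.Unary.Any.Properties using (lookup-index)
open import Data.List.Relation.Unary.Unique.Propositional using (Unique)
import Data.List.Relation.Unary.Unique.Propositional.Properties as Unique
open import Data.Nat using (ℕ; zero; suc; _+_; _*_; _^_; _≤_; _<_; z≤n; s≤s; _≤?_; _%_)
import Data.Nat as ℕ
open import Data.Nat.DivMod using (m*n%n≡0)
open import Data.Nat.ListAction using (sum)
open import Data.Nat.ListAction.Properties using (sum-++; sum-↭)
open import Data.Nat.Properties
open import Data.Nat.Solver using (module +-*-Solver)
open import Data.Product using (Σ; ∃; _×_; _,_; proj₁; proj₂)
open import Data.Product.Properties using (≡-dec)
open import Data.Rational using (ℚ; 1ℚ; _/_; toℚᵘ)
import Data.Rational as ℚ
import Data.Rational.Properties as ℚ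
import Data.Rational.Unnormalised as ℚᵘ
import Data.Rational.Unnormalised.Properties as ℚᵘ
open import Data.Sum using (_⊎_; inj₁; inj₂)
open import Data.Vec using (lookup; []; _∷_)
import Data.Vec as Vec
import Data.Vec.Properties as Vec
open import Data.Vec.Properties using ([]=⇒lookup; lookup⇒[]=)
open import Function using (_∘_; id)
open import Relation.Binary using (DecidableEquality; tri<; tri≈; tri>)
open import Relation.Binary.PropositionalEquality
open import Relation.Nullary using (¬_; Dec; yes; no; does; contradiction; _×-dec_)
open import Relation.Nullary.Decidable using (dec-true)

private variable
  A B V : Set
  n m : ℕ

-- Sums over lists

∑ : (A → ℕ) → List A → ℕ
∑ f xs = sum (map f xs)

𝟙 : Bool → ℕ
𝟙 true  = 1
𝟙 false = 0

∑-mono : {f g : A → ℕ} → (∀ x → f x ≤ g x) → ∀ xs → ∑ f xs ≤ ∑ g xs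
∑-mono le []       = z≤n
∑-mono le (x ∷ xs) = +-mono-≤ (le x) (∑-mono le xs)

∑-mono-∈ : {f g : A → ℕ} → ∀ xs → (∀ {x} → x List.∈ xs → f x ≤ g x) → ∑ f xs ≤ ∑ g xs
∑-mono-∈ []       le = z≤n
∑-mono-∈ (x ∷ xs) le = +-mono-≤ (le (here refl)) (∑-mono-∈ xs (le ∘ there))

∑-cong : {f g : A → ℕ} → (∀ x → f x ≡ g x) → ∀ xs → ∑ f xs ≡ ∑ g xs
∑-cong eq []       = refl
∑-cong eq (x ∷ xs) = cong₂ _+_ (eq x) (∑-cong eq xs)

∑-+ : (f g : A → ℕ) → ∀ xs → ∑ (λ x → f x + g x) xs ≡ ∑ f xs + ∑ g xs
∑-+ f g []       = refl
∑-+ f g (x ∷ xs) = trans (cong (f x + g x +_) (∑-+ f g xs))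
  (interchange +-commutativeSemigroup (f x) (g x) (∑ f xs) (∑ g xs))

∑-const : ∀ c (xs : List A) → ∑ (λ _ → c) xs ≡ length xs * c
∑-const c []       = refl
∑-const c (x ∷ xs) = cong (c +_) (∑-const c xs)

∑-*ʳ : ∀ (f : A → ℕ) c xs → ∑ (λ x → f x * c) xs ≡ ∑ f xs * c
∑-*ʳ f c []       = refl
∑-*ʳ f c (x ∷ xs) = trans (cong (f x * c +_) (∑-*ʳ f c xs)) (sym (*-distribʳ-+ c (f x) (∑ f xs)))

∑-swap : (f : A → B → ℕ) → ∀ xs ys → ∑ (λ x → ∑ (f x) ys) xs ≡ ∑ (λ y → ∑ (λ x → f x y) xs) ys
∑-swap f []       ys = sym (trans (∑-const 0 ys) (*-zeroʳ (length ys)))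
∑-swap f (x ∷ xs) ys = trans (cong (∑ (f x) ys +_) (∑-swap f xs ys))
  (sym (∑-+ (f x) (λ y → ∑ (λ x → f x y) xs) ys))

∑-∈ : (f : A → ℕ) → ∀ {x xs} → x List.∈ xs → f x ≤ ∑ f xs
∑-∈ f {xs = _ ∷ xs} (here refl) = m≤m+n _ (∑ f xs)
∑-∈ f {xs = y ∷ _}  (there p)   = ≤-trans (∑-∈ f p) (m≤n+m _ (f y))

∑-↭ : (f : A → ℕ) → ∀ {xs ys} → xs ↭ ys → ∑ f xs ≡ ∑ f ys
∑-↭ f p = sum-↭ (↭.map⁺ f p)

∑-++ : (f : A → ℕ) → ∀ xs ys → ∑ f (xs ++ ys) ≡ ∑ f xs + ∑ f ys
∑-++ f xs ys = trans (cong sum (map-++ f xs ys)) (sum-++ (map f xs) (map f ys))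

∑-map : (f : B → ℕ) (g : A → B) → ∀ xs → ∑ f (map g xs) ≡ ∑ (f ∘ g) xs
∑-map f g xs = cong sum (sym (map-∘ xs))

∑-concatMap : (f : B → ℕ) (g : A → List B) → ∀ xs → ∑ f (concatMap g xs) ≡ ∑ (λ x → ∑ f (g x)) xs
∑-concatMap f g []       = refl
∑-concatMap f g (x ∷ xs) = trans (∑-++ f (g x) (concatMap g xs))
  (cong (∑ f (g x) +_) (∑-concatMap f g xs))

length-filter≡∑ : {P : A → Set} (P? : ∀ x → Dec (P x)) → ∀ xs →
  length (filter P? xs) ≡ ∑ (𝟙 ∘ does ∘ P?) xs
length-filter≡∑ P? [] = refl
length-filter≡∑ P? (x ∷ xs) with does (P? x)
... | true  = cong suc (length-filter≡∑ P? xs)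
... | false = length-filter≡∑ P? xs

-- Counting an entry `x` that lies in `p` uses up one point: by uniqueness the rest of `L` avoids
-- `x`, so `p - x` counts it.
∑-∈-Unique : ∀ (p : Subset n) {L} → Unique L → ∑ (𝟙 ∘ lookup p) L ≤ ∣ p ∣
∑-∈-Unique p [] = z≤n
∑-∈-Unique p {x ∷ L} (x∉L ∷ uL) with lookup p x in eq
... | false = ∑-∈-Unique p uL
... | true  = begin
    suc (∑ (𝟙 ∘ lookup p) L)       ≤⟨ s≤s (∑-mono-∈ L drop) ⟩
    suc (∑ (𝟙 ∘ lookup (p - x)) L) ≤⟨ s≤s (∑-∈-Unique (p - x) uL) ⟩
    suc ∣ p - x ∣                  ≤⟨ x∈p⇒∣p-x∣<∣p∣ (lookup⇒[]= x p eq) ⟩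
    ∣ p ∣                          ∎
  where
  open ≤-Reasoning
  drop : ∀ {y} → y List.∈ L → 𝟙 (lookup p y) ≤ 𝟙 (lookup (p - x) y)
  drop {y} y∈L with lookup p y in eqy
  ... | false = z≤n
  ... | true rewrite []=⇒lookup (x∈p∧x≢y⇒x∈p-y (lookup⇒[]= y p eqy) (≢-sym (All.lookup x∉L y∈L))) =
    ≤-refl

-- Subsets of a finite set

∣p∪q∣≤∣p∣+∣q∣ : (p q : Subset n) → ∣ p ∪ q ∣ ≤ ∣ p ∣ + ∣ q ∣
∣p∪q∣≤∣p∣+∣q∣ []            []            = z≤n
∣p∪q∣≤∣p∣+∣q∣ (outside ∷ p) (outside ∷ q) = ∣p∪q∣≤∣p∣+∣q∣ p q
∣p∪q∣≤∣p∣+∣q∣ (outside ∷ p) (inside ∷ q)  =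
  ≤-trans (s≤s (∣p∪q∣≤∣p∣+∣q∣ p q)) (≤-reflexive (sym (+-suc _ _)))
∣p∪q∣≤∣p∣+∣q∣ (inside ∷ p)  (outside ∷ q) = s≤s (∣p∪q∣≤∣p∣+∣q∣ p q)
∣p∪q∣≤∣p∣+∣q∣ (inside ∷ p)  (inside ∷ q)  =
  s≤s (≤-trans (∣p∪q∣≤∣p∣+∣q∣ p q) (+-monoʳ-≤ ∣ p ∣ (n≤1+n _)))

∣⋃∣≤ : ∀ k (ps : List (Subset n)) → All (λ p → ∣ p ∣ ≤ k) ps → ∣ ⋃ ps ∣ ≤ length ps * k
∣⋃∣≤ {n} k []       []        = ≤-reflexive (∣⊥∣≡0 n)
∣⋃∣≤ k (p ∷ ps) (le ∷ les) = ≤-trans (∣p∪q∣≤∣p∣+∣q∣ p (⋃ ps)) (+-mono-≤ le (∣⋃∣≤ k ps les))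

∣p∩q∣+∣p─q∣ : (p q : Subset n) → ∣ p ∩ q ∣ + ∣ p ─ q ∣ ≡ ∣ p ∣
∣p∩q∣+∣p─q∣ []            []            = refl
∣p∩q∣+∣p─q∣ (outside ∷ p) (outside ∷ q) = ∣p∩q∣+∣p─q∣ p q
∣p∩q∣+∣p─q∣ (outside ∷ p) (inside ∷ q)  = ∣p∩q∣+∣p─q∣ p q
∣p∩q∣+∣p─q∣ (inside ∷ p)  (outside ∷ q) = trans (+-suc _ _) (cong suc (∣p∩q∣+∣p─q∣ p q))
∣p∩q∣+∣p─q∣ (inside ∷ p)  (inside ∷ q)  = cong suc (∣p∩q∣+∣p─q∣ p q)

∣p∩q∣-split : (p q s : Subset n) → ∣ p ∩ q ∣ ≡ ∣ (p ∩ s) ∩ (q ∩ s) ∣ + ∣ (p ─ s) ∩ (q ─ s) ∣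
∣p∩q∣-split []      []      []            = refl
∣p∩q∣-split (false ∷ p) (_ ∷ q) (inside ∷ s) = ∣p∩q∣-split p q s
∣p∩q∣-split (true ∷ p) (false ∷ q) (inside ∷ s) = ∣p∩q∣-split p q s
∣p∩q∣-split (true ∷ p) (true ∷ q) (inside ∷ s) = cong suc (∣p∩q∣-split p q s)
∣p∩q∣-split (false ∷ p) (_ ∷ q) (outside ∷ s) = ∣p∩q∣-split p q s
∣p∩q∣-split (true ∷ p) (false ∷ q) (outside ∷ s) = ∣p∩q∣-split p q s
∣p∩q∣-split (true ∷ p) (true ∷ q) (outside ∷ s) = trans (cong suc (∣p∩q∣-split p q s)) (sym (+-suc _ _))

subsets : ∀ n → List (Subset n)
subsets zero    = [] ∷ []
subsets (suc n) = map (inside ∷_) (subsets n) ++ map (outside ∷_) (subsets n)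

length-subsets : ∀ n → length (subsets n) ≡ 2 ^ n
length-subsets zero    = refl
length-subsets (suc n) = begin
  length (subsets (suc n))
    ≡⟨ length-++ (map (inside ∷_) (subsets n)) ⟩
  length (map (inside ∷_) (subsets n)) + length (map (outside ∷_) (subsets n))
    ≡⟨ cong₂ _+_ (length-map (inside ∷_) (subsets n)) (length-map (outside ∷_) (subsets n)) ⟩
  length (subsets n) + length (subsets n)
    ≡⟨ cong₂ _+_ (length-subsets n) (trans (length-subsets n) (sym (+-identityʳ _))) ⟩
  2 ^ suc n ∎
  where open ≡-Reasoning

-- A random `S` has trace `E` on `A` with probability one in `2 ^ ∣ A ∣`; denominators are cleared.
-- At a point of `A` only one of the two choices for `S` agrees with `E`, and a factor 2 of
-- `2 ^ ∣ A ∣` pays for it; at any other point both choices agree and both halves count.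
∑-subsets-≥ : ∀ {n} (A E : Subset n) → E ⊆ A → ∀ (g : Subset n → ℕ) t →
  (∀ S → A ∩ S ≡ E → t ≤ g S) → 2 ^ n * t ≤ 2 ^ ∣ A ∣ * ∑ g (subsets n)
∑-subsets-≥ [] [] _ g t h = *-monoʳ-≤ 1 (≤-trans (h [] refl) (m≤m+n _ 0))
∑-subsets-≥ {suc n} (a ∷ A) (e ∷ E) E⊆A g t h = begin
  2 * 2 ^ n * t ≡⟨ *-assoc 2 (2 ^ n) t ⟩
  2 * (2 ^ n * t) ≤⟨ step a e E⊆A h ⟩
  2 ^ ∣ a ∷ A ∣ * (∑ gᵢ Ss + ∑ gₒ Ss) ≡⟨ cong (2 ^ ∣ a ∷ A ∣ *_) (sym split) ⟩
  2 ^ ∣ a ∷ A ∣ * ∑ g (subsets (suc n)) ∎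
  where
  open ≤-Reasoning
  Ss = subsets n
  gᵢ = λ S → g (inside ∷ S)
  gₒ = λ S → g (outside ∷ S)
  split : ∑ g (subsets (suc n)) ≡ ∑ gᵢ Ss + ∑ gₒ Ss
  split = trans (∑-++ g (map (inside ∷_) Ss) _)
    (cong₂ _+_ (∑-map g (inside ∷_) Ss) (∑-map g (outside ∷_) Ss))
  ih : E ⊆ A → ∀ g → (∀ S → A ∩ S ≡ E → t ≤ g S) → 2 ^ n * t ≤ 2 ^ ∣ A ∣ * ∑ g Ss
  ih sub g = ∑-subsets-≥ A E sub g t
  half : ∀ x → 2 ^ n * t ≤ 2 ^ ∣ A ∣ * x → ∀ y → x ≤ y → 2 * (2 ^ n * t) ≤ 2 * 2 ^ ∣ A ∣ * y
  half x le y x≤y = ≤-trans (*-monoʳ-≤ 2 (≤-trans le (*-monoʳ-≤ (2 ^ ∣ A ∣) x≤y)))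
    (≤-reflexive (sym (*-assoc 2 (2 ^ ∣ A ∣) y)))
  step : ∀ a e → (e ∷ E) ⊆ (a ∷ A) → (∀ S → (a ∷ A) ∩ S ≡ e ∷ E → t ≤ g S) →
    2 * (2 ^ n * t) ≤ 2 ^ ∣ a ∷ A ∣ * (∑ gᵢ Ss + ∑ gₒ Ss)
  step true true sub h =
    half _ (ih (drop-∷-⊆ sub) gᵢ (λ S eq → h (inside ∷ S) (cong (inside ∷_) eq))) _ (m≤m+n _ _)
  step true false sub h =
    half _ (ih (drop-∷-⊆ sub) gₒ (λ S eq → h (outside ∷ S) (cong (outside ∷_) eq))) _ (m≤n+m _ (∑ gᵢ Ss))
  step false true sub h with () ← sub Vec.here
  step false false sub h = begin
    2 * (2 ^ n * t) ≡⟨ cong (2 ^ n * t +_) (+-identityʳ _) ⟩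
    2 ^ n * t + 2 ^ n * t
      ≤⟨ +-mono-≤ (ih (drop-∷-⊆ sub) gᵢ (λ S eq → h (inside ∷ S) (cong (outside ∷_) eq)))
                  (ih (drop-∷-⊆ sub) gₒ (λ S eq → h (outside ∷ S) (cong (outside ∷_) eq))) ⟩
    2 ^ ∣ A ∣ * ∑ gᵢ Ss + 2 ^ ∣ A ∣ * ∑ gₒ Ss ≡⟨ sym (*-distribˡ-+ (2 ^ ∣ A ∣) _ _) ⟩
    2 ^ ∣ A ∣ * (∑ gᵢ Ss + ∑ gₒ Ss) ∎

-- Greedy colouring

-- Pigeonhole: if every colour occurred in `cs`, positions of occurrence would inject `Fin K` into
-- the smaller `Fin (length cs)`.
freshColour : ∀ {K} (cs : List (Fin K)) → length cs < K → ∃ λ c → ¬ c List.∈ cs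
freshColour {K} cs cs<K = Fin.¬∀⟶∃¬ K (List._∈ cs) (λ c → DecMembership._∈?_ Fin._≟_ c cs) λ all∈ →
  Fin.<⇒notInjective {f = Any.index ∘ all∈} cs<K λ {c} {d} eq →
    trans (lookup-index (all∈ c)) (trans (cong (List.lookup cs) eq) (sym (lookup-index (all∈ d))))

-- The tail is coloured first; the head then takes a colour that no conflicting entry of the tail
-- uses. Degrees are counted along the list, so their bound passes to the tail.
greedyColouring : DecidableEquality V → (conf : V → V → Bool) → (∀ x y → conf x y ≡ conf y x) →
  ∀ {K} → 0 < K → ∀ es → (∀ {e} → e List.∈ es → ∑ (𝟙 ∘ conf e) es < K) →
  ∃ λ (col : V → Fin K) →
    ∀ {x y} → x List.∈ es → y List.∈ es → x ≢ y → conf x y ≡ true → col x ≢ col y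
greedyColouring _≟_ conf conf-sym {suc _} 0<K [] h = (λ _ → Fin.zero) , λ ()
greedyColouring {V = V} _≟_ conf conf-sym {K} 0<K (e ∷ es) h = col , proper
  where
  rec = greedyColouring _≟_ conf conf-sym 0<K es
    (λ {x} x∈ → ≤-<-trans (m≤n+m _ (𝟙 (conf x e))) (h (there x∈)))
  col′ = proj₁ rec
  conf? : ∀ x → Dec (conf e x ≡ true)
  conf? x = conf e x Bool.≟ true
  used = map col′ (filter conf? es)
  does-conf : ∀ x → 𝟙 (does (conf? x)) ≡ 𝟙 (conf e x)
  does-conf x with conf e x
  ... | true = refl
  ... | false = refl
  used<K : length used < K
  used<K = begin-strict
    length used ≡⟨ length-map col′ (filter conf? es) ⟩
    length (filter conf? es) ≡⟨ length-filter≡∑ conf? es ⟩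
    ∑ (𝟙 ∘ does ∘ conf?) es ≡⟨ ∑-cong does-conf es ⟩
    ∑ (𝟙 ∘ conf e) es ≤⟨ m≤n+m _ (𝟙 (conf e e)) ⟩
    ∑ (𝟙 ∘ conf e) (e ∷ es) <⟨ h (here refl) ⟩
    K ∎
    where open ≤-Reasoning
  fresh = freshColour used used<K
  col : V → Fin K
  col x with x ≟ e
  ... | yes _ = proj₁ fresh
  ... | no  _ = col′ x
  e-proper : ∀ {y} → y List.∈ es → conf e y ≡ true → proj₁ fresh ≢ col′ y
  e-proper y∈ cf eq = proj₂ fresh (subst (List._∈ used) (sym eq) (∈-map⁺ col′ (∈-filter⁺ conf? y∈ cf)))
  tail∈ : ∀ {x} → x ≢ e → x List.∈ e ∷ es → x List.∈ es
  tail∈ x≢e (here x≡e) = contradiction x≡e x≢e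
  tail∈ x≢e (there x∈) = x∈
  proper : ∀ {x y} → x List.∈ e ∷ es → y List.∈ e ∷ es → x ≢ y → conf x y ≡ true → col x ≢ col y
  proper {x} {y} x∈ y∈ x≢y cf with x ≟ e | y ≟ e
  ... | yes refl | yes refl = contradiction refl x≢y
  ... | yes refl | no y≢e = e-proper (tail∈ y≢e y∈) cf
  ... | no x≢e | yes refl = e-proper (tail∈ x≢e x∈) (trans (conf-sym y x) cf) ∘ sym
  ... | no x≢e | no y≢e = proj₂ rec (tail∈ x≢e x∈) (tail∈ y≢e y∈) x≢y cf

-- Digraphs of bounded outdegree

-- `R v u` stands for an edge from `v` to `u`. Bounding the outdegree into every duplicate-free list
-- keeps `Δ` fixed while vertices are removed.
module Digraph {V : Set} (_≟_ : DecidableEquality V) (R : V → V → Bool) (Δ : ℕ)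
  (outdegree : ∀ v {L} → Unique L → ∑ (𝟙 ∘ R v) L ≤ Δ) where

  indegree : V → List V → ℕ
  indegree u = ∑ (λ v → 𝟙 (R v u))

  -- A degeneracy ordering for in-edges: only those from later vertices of the list are counted.
  data Ordered : List V → Set where
    []  : Ordered []
    _∷_ : ∀ {u L} → indegree u L ≤ Δ → Ordered L → Ordered (u ∷ L)

  -- Double counting: the indegrees within the list add up to the outdegrees, hence to at most `Δ`
  -- per vertex on average.
  smallIndegree : ∀ x L → Unique (x ∷ L) → Any (λ u → indegree u (x ∷ L) ≤ Δ) (x ∷ L)
  smallIndegree x L uL with any? (λ u → indegree u (x ∷ L) ≤? Δ) (x ∷ L)
  ... | yes p = p
  ... | no ¬p = contradiction (begin-strict
      length S * Δ                     <⟨ +-monoˡ-< (length L * Δ) (n<1+n Δ) ⟩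
      suc Δ + length L * Δ             ≤⟨ +-monoʳ-≤ (suc Δ) (*-monoʳ-≤ (length L) (n≤1+n Δ)) ⟩
      length S * suc Δ                 ≡⟨ sym (∑-const (suc Δ) S) ⟩
      ∑ (λ _ → suc Δ) S                ≤⟨ ∑-mono-∈ S (λ {u} u∈ → ≰⇒> (λ le → ¬p (lose u∈ le))) ⟩
      ∑ (λ u → indegree u S) S         ≡⟨ ∑-swap (λ u v → 𝟙 (R v u)) S S ⟩
      ∑ (λ v → ∑ (𝟙 ∘ R v) S) S        ≤⟨ ∑-mono (λ v → outdegree v uL) S ⟩
      ∑ (λ _ → Δ) S                    ≡⟨ ∑-const Δ S ⟩
      length S * Δ                     ∎) (<-irrefl refl)
    where
    open ≤-Reasoning
    S = x ∷ L

  -- A vertex of small indegree goes first and the rest is ordered recursively; removing it cannot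
  -- raise its indegree. The length `N` is the measure of the recursion, because the vertex may be
  -- removed from the middle.
  order : ∀ N S → length S ≡ N → Unique S → ∃ λ L → Ordered L × L ↭ S
  order zero [] eq uS = [] , [] , ↭-refl
  order (suc N) (x ∷ S′) eq uS
    with u , u∈ , small ← find (smallIndegree x S′ uS)
    with xs , ys , S≡ ← ∈-∃++ u∈ =
    u ∷ proj₁ rec , le ∷ proj₁ (proj₂ rec) , ↭-trans (↭-prep u perm) (↭-sym S↭)
    where
    S↭ : x ∷ S′ ↭ u ∷ (xs ++ ys)
    S↭ = subst (_↭ u ∷ (xs ++ ys)) (sym S≡) (↭.shift u xs ys)
    rec = order N (xs ++ ys) (suc-injective (trans (sym (↭.↭-length S↭)) eq))
      (AllPairs.tail (↭ₛ.Unique-resp-↭ (setoid V) (↭⇒↭ₛ S↭) uS))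
    perm = proj₂ (proj₂ rec)
    le : indegree u (proj₁ rec) ≤ Δ
    le = begin
      indegree u (proj₁ rec) ≡⟨ ∑-↭ _ perm ⟩
      indegree u (xs ++ ys) ≤⟨ m≤n+m _ _ ⟩
      indegree u (u ∷ xs ++ ys) ≡⟨ sym (∑-↭ _ S↭) ⟩
      indegree u (x ∷ S′) ≤⟨ small ⟩
      Δ ∎
      where open ≤-Reasoning

  inEdges : V → List V → List (V × V)
  inEdges u L = map (_, u) (filter (λ v → R v u Bool.≟ true) L)

  backEdges : List V → List (V × V)
  backEdges []      = []
  backEdges (u ∷ L) = inEdges u L ++ backEdges L

  ∈-inEdges : ∀ {u v L} → v List.∈ L → R v u ≡ true → (v , u) List.∈ inEdges u L
  ∈-inEdges {u} v∈L Rvu = ∈-map⁺ (_, u) (∈-filter⁺ (λ v → R v u Bool.≟ true) v∈L Rvu)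

  ∈-backEdges⇒R : ∀ L {e} → e List.∈ backEdges L → R (proj₁ e) (proj₂ e) ≡ true
  ∈-backEdges⇒R (u ∷ L) e∈ with ∈-++⁻ (inEdges u L) e∈
  ... | inj₂ e∈back = ∈-backEdges⇒R L e∈back
  ... | inj₁ e∈in with v , v∈ , refl ← ∈-map⁻ (_, u) e∈in =
    proj₂ (∈-filter⁻ (λ v → R v u Bool.≟ true) {xs = L} v∈)

  ∑-inEdges : ∀ (f : V × V → ℕ) u L → ∑ f (inEdges u L) ≤ ∑ (λ v → f (v , u)) L
  ∑-inEdges f u [] = z≤n
  ∑-inEdges f u (v ∷ L) with R v u Bool.≟ true
  ... | yes _ = +-monoʳ-≤ (f (v , u)) (∑-inEdges f u L)
  ... | no _ = ≤-trans (∑-inEdges f u L) (m≤n+m _ (f (v , u)))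

  _==_ : V → V → ℕ
  x == y = 𝟙 (does (x ≟ y))

  ==-refl : ∀ x → x == x ≡ 1
  ==-refl x with x ≟ x
  ... | yes _ = refl
  ... | no x≢x = contradiction refl x≢x

  ==-≢ : ∀ {x y} → x ≢ y → x == y ≡ 0
  ==-≢ {x} {y} x≢y with x ≟ y
  ... | yes x≡y = contradiction x≡y x≢y
  ... | no _ = refl

  ∑-∉ : ∀ {x L} → All (x ≢_) L → ∑ (_== x) L ≡ 0
  ∑-∉ [] = refl
  ∑-∉ (x≢y ∷ x∉L) = cong₂ _+_ (==-≢ (x≢y ∘ sym)) (∑-∉ x∉L)

  ∑-tails-inEdges : ∀ x u {L} → Unique L → ∑ (λ e → proj₁ e == x) (inEdges u L) ≤ 𝟙 (R x u)
  ∑-tails-inEdges x u {[]} [] = z≤n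
  ∑-tails-inEdges x u {v ∷ L} (v∉L ∷ uL) with R v u Bool.≟ true
  ... | no _ = ∑-tails-inEdges x u uL
  ... | yes Rvu with v ≟ x
  ...   | no _ = ∑-tails-inEdges x u uL
  ...   | yes refl rewrite Rvu = s≤s (≤-trans (∑-inEdges _ u L) (≤-reflexive (∑-∉ v∉L)))

  -- Each `u` of the list accounts for at most one back edge leaving `x`, and only if `R x u`.
  tails≤ : ∀ x {L} → Unique L → ∑ (λ e → proj₁ e == x) (backEdges L) ≤ ∑ (𝟙 ∘ R x) L
  tails≤ x [] = z≤n
  tails≤ x {u ∷ L} (_ ∷ uL) = ≤-trans (≤-reflexive (∑-++ _ (inEdges u L) (backEdges L)))
    (+-mono-≤ (∑-tails-inEdges x u uL) (tails≤ x uL))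

  ∑-heads-inEdges : ∀ x u L → ∑ (λ e → proj₂ e == x) (inEdges u L) ≤ (u == x) * indegree u L
  ∑-heads-inEdges x u [] = z≤n
  ∑-heads-inEdges x u (v ∷ L) with R v u in eq
  ... | false = ∑-heads-inEdges x u L
  ... | true = ≤-trans (+-monoʳ-≤ (u == x) (∑-heads-inEdges x u L))
    (≤-reflexive (sym (*-suc (u == x) (indegree u L))))

  ∑-heads-∉ : ∀ {x L} → All (x ≢_) L → ∑ (λ e → proj₂ e == x) (backEdges L) ≡ 0
  ∑-heads-∉ [] = refl
  ∑-heads-∉ {x} {u ∷ L} (x≢u ∷ x∉L) = trans (∑-++ _ (inEdges u L) (backEdges L))
    (cong₂ _+_ none (∑-heads-∉ x∉L))
    where
    none : ∑ (λ e → proj₂ e == x) (inEdges u L) ≡ 0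
    none = n≤0⇒n≡0 (subst (λ i → ∑ (λ e → proj₂ e == x) (inEdges u L) ≤ i * indegree u L)
      (==-≢ (≢-sym x≢u)) (∑-heads-inEdges x u L))

  -- Edges into `x` are added only at an occurrence of `x` in the list. There is at most one, and
  -- `Ordered` bounds the number of edges added there.
  heads≤ : ∀ x {L} → Ordered L → Unique L → ∑ (λ e → proj₂ e == x) (backEdges L) ≤ Δ
  heads≤ x [] [] = z≤n
  heads≤ x {u ∷ L} (small ∷ oL) (u∉L ∷ uL) =
    ≤-trans (≤-reflexive (∑-++ _ (inEdges u L) (backEdges L))) bound
    where
    bound : ∑ (λ e → proj₂ e == x) (inEdges u L) + ∑ (λ e → proj₂ e == x) (backEdges L) ≤ Δ
    bound with u ≟ x | ∑-heads-inEdges x u L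
    ... | yes refl | le rewrite ∑-heads-∉ u∉L = begin
      _ + 0 ≡⟨ +-identityʳ _ ⟩
      _ ≤⟨ le ⟩
      indegree u L + 0 ≡⟨ +-identityʳ _ ⟩
      indegree u L ≤⟨ small ⟩
      Δ ∎ where open ≤-Reasoning
    ... | no _ | le = ≤-trans (+-monoˡ-≤ _ le) (heads≤ x oL uL)

  degree≤ : ∀ x {L} → Ordered L → Unique L →
    ∑ (λ e → proj₁ e == x + proj₂ e == x) (backEdges L) ≤ Δ + Δ
  degree≤ x {L} oL uL = ≤-trans (≤-reflexive (∑-+ _ _ (backEdges L)))
    (+-mono-≤ (≤-trans (tails≤ x uL) (outdegree x uL)) (heads≤ x oL uL))

  -- The witness is the last element of L satisfying P.
  lastVertex : {P : V → Set} → (∀ v → Dec (P v)) → ∀ {L} → Any P L →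
    ∃ λ v → P v × (∀ {w} → w List.∈ L → P w → w ≢ v → R v w ≡ true → (v , w) List.∈ backEdges L)
  lastVertex {P} P? {L} p = let v , _ , rest = go p in v , rest
    where
    go : ∀ {L} → Any P L →
      ∃ λ v → v List.∈ L × P v ×
        (∀ {w} → w List.∈ L → P w → w ≢ v → R v w ≡ true → (v , w) List.∈ backEdges L)
    go {u ∷ L} p with any? P? L
    ... | yes q = let v , v∈ , Pv , h = go q in v , there v∈ , Pv , λ where
      (here refl) _ _ Rvu → ∈-++⁺ˡ (∈-inEdges v∈ Rvu)
      (there w∈) Pw w≢v Rvw → ∈-++⁺ʳ (inEdges u L) (h w∈ Pw w≢v Rvw)
    go {u ∷ L} (there q) | no ¬q = contradiction q ¬q
    go {u ∷ L} (here Pu) | no ¬q = u , here refl , Pu , λ where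
      (here refl) _ w≢u _ → contradiction refl w≢u
      (there w∈) Pw _ _ → contradiction (lose w∈ Pw) ¬q

-- Parity and further facts on subsets

𝟙-does≤ : {P : Set} (P? : Dec P) → ∀ {t} → (P → 1 ≤ t) → 𝟙 (does P?) ≤ t
𝟙-does≤ (yes p) le = le p
𝟙-does≤ (no _)  le = z≤n

Odd? : ∀ a → Dec (Odd a)
Odd? a = a % 2 ℕ.≟ 1

Odd-+-cancelˡ : ∀ a {b} → ¬ Odd a → Odd (a + b) → Odd b
Odd-+-cancelˡ zero          _  o = o
Odd-+-cancelˡ (suc zero)    ¬o _ = contradiction refl ¬o
Odd-+-cancelˡ (suc (suc a)) ¬o o = Odd-+-cancelˡ a ¬o o

Odd-+ˡ : ∀ a {b} → ¬ Odd a → Odd b → Odd (a + b)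
Odd-+ˡ zero          _  o = o
Odd-+ˡ (suc zero)    ¬o _ = contradiction refl ¬o
Odd-+ˡ (suc (suc a)) ¬o o = Odd-+ˡ a ¬o o

-- Removing `q` a second time changes nothing, but a common point of `p ─ q` and `q` would make the
-- set strictly smaller.
x∈p─q⇒x∉q : ∀ (p q : Subset n) {x} → x ∈ p ─ q → x ∉ q
x∈p─q⇒x∉q p q x∈p─q x∈q =
  ⊂-irref (p─q─q≡p─q p q) (p∩q≢∅⇒p─q⊂p (p ─ q) q (_ , x∈p∩q⁺ (x∈p─q , x∈q)))

x∈p-y⇒x≢y : ∀ (p : Subset n) {x y} → x ∈ p - y → x ≢ y
x∈p-y⇒x≢y p {x} x∈p-y refl = x∈p─q⇒x∉q p ⁅ x ⁆ x∈p-y (x∈⁅x⁆ x)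

Empty⇒∣p∣≡0 : ∀ {p : Subset n} → Empty p → ∣ p ∣ ≡ 0
Empty⇒∣p∣≡0 {n} empty = trans (cong ∣_∣ (Empty-unique empty)) (∣⊥∣≡0 n)

∈-⋃ : ∀ {x} {A : Subset n} {As} → A List.∈ As → x ∈ A → x ∈ ⋃ As
∈-⋃ {As = _ ∷ As} (here refl) x∈A = p⊆p∪q (⋃ As) x∈A
∈-⋃ {As = B ∷ As} (there A∈)  x∈A = q⊆p∪q B (⋃ As) (∈-⋃ A∈ x∈A)

-- Sunflowers with a one-point kernel

OddMeet : Subset n → Subset n → Set
OddMeet A B = Odd ∣ A ∩ B ∣

-- Cliques are lists with no demand of distinctness: `AllPairs OddMeet` already forbids repeating a
-- set of even size. Bounding the length also gives `0 < m`, from the empty list.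
NoClique : ℕ → List (Subset n) → Set
NoClique m P = ∀ xs → All (List._∈ P) xs → AllPairs OddMeet xs → length xs < m

-- Greedy construction of a maximal sunflower: a member through `v` joins if it misses the petals
-- chosen so far outside `v`. It then meets each chosen set in `v` alone, so in one point. A member
-- that does not join is hit already, and stays hit as the union grows.
sunflower : ∀ v (P : List (Subset n)) → (∀ {A} → A List.∈ P → 2 ≤ ∣ A ∣) →
  ∃ λ xs → All (List._∈ P) xs × All (v ∈_) xs × AllPairs OddMeet xs ×
    (∀ {A} → A List.∈ P → v ∈ A → Nonempty (A ∩ (⋃ xs - v)))
sunflower v [] _ = [] , [] , [] , [] , λ ()
sunflower v (A ∷ P) 2≤
  with xs , xs⊆P , v∈xs , odd , hits ← sunflower v P (2≤ ∘ there)
  with v ∈? A | nonempty? (A ∩ (⋃ xs - v))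
... | no v∉A | _ = xs , All.map there xs⊆P , v∈xs , odd , λ where
  (here refl) v∈A → contradiction v∈A v∉A
  (there B∈)  v∈B → hits B∈ v∈B
... | yes _ | yes hit = xs , All.map there xs⊆P , v∈xs , odd , λ where
  (here refl) _   → hit
  (there B∈)  v∈B → hits B∈ v∈B
... | yes v∈A | no ¬hit =
  A ∷ xs , here refl ∷ All.map there xs⊆P , v∈A ∷ v∈xs , All.tabulate meetsOnlyAt-v ∷ odd , hits′
  where
  meetsOnlyAt-v : ∀ {B} → B List.∈ xs → OddMeet A B
  meetsOnlyAt-v {B} B∈ = cong (_% 2) (trans (cong ∣_∣ (⊆-antisym A∩B⊆v v⊆A∩B)) (∣⁅x⁆∣≡1 v))
    where
    A∩B⊆v : A ∩ B ⊆ ⁅ v ⁆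
    A∩B⊆v {x} x∈ with x Fin.≟ v | x∈p∩q⁻ A B x∈
    ... | yes refl | _ = x∈⁅x⁆ v
    ... | no x≢v | x∈A , x∈B =
      contradiction (x , x∈p∩q⁺ (x∈A , x∈p∧x≢y⇒x∈p-y (∈-⋃ B∈ x∈B) x≢v)) ¬hit
    v⊆A∩B : ⁅ v ⁆ ⊆ A ∩ B
    v⊆A∩B x∈ rewrite x∈⁅y⁆⇒x≡y v x∈ = x∈p∩q⁺ (v∈A , All.lookup v∈xs B∈)
  -- The new petal must itself be hit once `v` is deleted from the union, which is where `2 ≤ ∣ A ∣`
  -- enters.
  secondElement : ∃ λ w → w ∈ A × w ≢ v
  secondElement with nonempty? (A - v)
  ... | yes (w , w∈) = w , p─q⊆p A ⁅ v ⁆ w∈ , x∈p-y⇒x≢y A w∈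
  ... | no empty =
    contradiction (≤-trans (2≤ (here refl)) (≤-trans (p⊆q⇒∣p∣≤∣q∣ A⊆v) (≤-reflexive (∣⁅x⁆∣≡1 v)))) 1+n≰n
    where
    A⊆v : A ⊆ ⁅ v ⁆
    A⊆v {x} x∈A with x Fin.≟ v
    ... | yes refl = x∈⁅x⁆ v
    ... | no x≢v = contradiction (x , x∈p∧x≢y⇒x∈p-y x∈A x≢v) empty
  hits′ : ∀ {B} → B List.∈ A ∷ P → v ∈ B → Nonempty (B ∩ (⋃ (A ∷ xs) - v))
  hits′ (here refl) _ with w , w∈A , w≢v ← secondElement =
    w , x∈p∩q⁺ (w∈A , x∈p∧x≢y⇒x∈p-y (p⊆p∪q (⋃ xs) w∈A) w≢v)
  hits′ {B} (there B∈) v∈B with w , w∈ ← hits B∈ v∈B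
    with w∈B , w∈U ← x∈p∩q⁻ B (⋃ xs - v) w∈ =
    w , x∈p∩q⁺ (w∈B , x∈p∧x≢y⇒x∈p-y (q⊆p∪q A (⋃ xs) (p─q⊆p (⋃ xs) ⁅ v ⁆ w∈U))
      (x∈p-y⇒x≢y (⋃ xs) w∈U))

-- Colouring the edges inside members

Edge : ℕ → Set
Edge n = Fin n × Fin n

pair : Edge n → Subset n
pair (v , u) = ⁅ v ⁆ ∪ ⁅ u ⁆

∈-pair : ∀ (e : Edge n) {x} → x ∈ pair e → x ≡ proj₁ e ⊎ x ≡ proj₂ e
∈-pair (v , u) x∈ with x∈p∪q⁻ ⁅ v ⁆ ⁅ u ⁆ x∈
... | inj₁ x∈v = inj₁ (x∈⁅y⁆⇒x≡y v x∈v)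
... | inj₂ x∈u = inj₂ (x∈⁅y⁆⇒x≡y u x∈u)

∣pair∣ : ∀ {v u : Fin n} → v ≢ u → ∣ pair (v , u) ∣ ≡ 2
∣pair∣ {v = v} {u} v≢u = ≤-antisym
  (≤-trans (∣p∪q∣≤∣p∣+∣q∣ ⁅ v ⁆ ⁅ u ⁆) (≤-reflexive (cong₂ _+_ (∣⁅x⁆∣≡1 v) (∣⁅x⁆∣≡1 u))))
  (subst (λ i → suc i ≤ ∣ pair (v , u) ∣) (∣⁅x⁆∣≡1 v)
    (p⊂q⇒∣p∣<∣q∣ (p⊆p∪q ⁅ u ⁆ , u , q⊆p∪q ⁅ v ⁆ ⁅ u ⁆ (x∈⁅x⁆ u) , x≢y⇒x∉⁅y⁆ (≢-sym v≢u))))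

-- For pairs of size 2 an odd intersection is a single shared end, so this is adjacency in the line
-- graph.
conflict : Edge n → Edge n → Bool
conflict e e′ = does (Odd? ∣ pair e ∩ pair e′ ∣)

conflict-sym : ∀ (e e′ : Edge n) → conflict e e′ ≡ conflict e′ e
conflict-sym e e′ = cong (does ∘ Odd? ∘ ∣_∣) (∩-comm (pair e) (pair e′))

record EdgeColouring (P : List (Subset n)) (K : ℕ) : Set where
  field
    edges  : List (Edge n)
    size-2 : ∀ {e} → e List.∈ edges → ∣ pair e ∣ ≡ 2
    inside-members : ∀ {A} → A List.∈ P → ∃ λ e → e List.∈ edges × pair e ⊆ A
    colour : Edge n → Fin K
    proper : ∀ {e e′} → e List.∈ edges → e′ List.∈ edges → colour e ≡ colour e′ →
      ¬ OddMeet (pair e) (pair e′)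

edgeColouring : ∀ k m (P : List (Subset n)) → 2 ≤ k → (∀ {A} → A List.∈ P → ∣ A ∣ ≡ k) →
  NoClique m P → EdgeColouring P ((1 + 4 * k) * m)
edgeColouring {n} k m P 2≤k uniform noClique = record
  { edges          = Es
  ; size-2         = size
  ; inside-members = inside-member
  ; colour         = proj₁ colouring
  ; proper         = proper
  }
  where
  2≤∣_∣ : ∀ {A} → A List.∈ P → 2 ≤ ∣ A ∣
  2≤∣ A∈ ∣ = subst (2 ≤_) (sym (uniform A∈)) 2≤k
  petals : Fin n → List (Subset n)
  petals v = proj₁ (sunflower v P 2≤∣_∣)
  U : Fin n → Subset n
  U v = ⋃ (petals v) - v
  v∉U : ∀ v → v ∉ U v
  v∉U v v∈ = x∈p-y⇒x≢y (⋃ (petals v)) v∈ refl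
  ∣U∣≤ : ∀ v → ∣ U v ∣ ≤ m * k
  ∣U∣≤ v with xs , xs⊆P , _ , odd , _ ← sunflower v P 2≤∣_∣ = begin
    ∣ ⋃ xs - v ∣  ≤⟨ ∣p─q∣≤∣p∣ (⋃ xs) ⁅ v ⁆ ⟩
    ∣ ⋃ xs ∣      ≤⟨ ∣⋃∣≤ k xs (All.map (≤-reflexive ∘ uniform) xs⊆P) ⟩
    length xs * k ≤⟨ *-monoˡ-≤ k (<⇒≤ (noClique xs xs⊆P odd)) ⟩
    m * k         ∎ where open ≤-Reasoning
  Δ = m * k
  R : Fin n → Fin n → Bool
  R v = lookup (U v)
  open Digraph Fin._≟_ R Δ (λ v uL → ≤-trans (∑-∈-Unique (U v) uL) (∣U∣≤ v))
  ordering = order (length (allFin n)) (allFin n) refl (Unique.allFin⁺ n)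
  L = proj₁ ordering
  L↭ = proj₂ (proj₂ ordering)
  oL = proj₁ (proj₂ ordering)
  uL : Unique L
  uL = ↭ₛ.Unique-resp-↭ (setoid (Fin n)) (↭⇒↭ₛ (↭-sym L↭)) (Unique.allFin⁺ n)
  Es = backEdges L
  v∈L : ∀ v → v List.∈ L
  v∈L v = ↭.∈-resp-↭ (↭-sym L↭) (∈-allFin v)
  size : ∀ {e} → e List.∈ Es → ∣ pair e ∣ ≡ 2
  size {v , u} e∈ = ∣pair∣ λ v≡u →
    v∉U v (lookup⇒[]= v (U v) (trans (cong (R v) v≡u) (∈-backEdges⇒R L e∈)))
  inside-member : ∀ {A} → A List.∈ P → ∃ λ e → e List.∈ Es × pair e ⊆ A
  inside-member {A} A∈ with nonempty? A
  ... | no empty = contradiction (subst (2 ≤_) (Empty⇒∣p∣≡0 empty) 2≤∣ A∈ ∣) λ ()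
  ... | yes (x , x∈A)
    -- The point `w` of `A ∩ U v` gives an edge from `v` that stays in `A`; as `v` comes last in
    -- `A`, it is a back edge.
    with v , v∈A , back ← lastVertex (_∈? A) (lose (v∈L x) x∈A)
    with w , w∈ ← proj₂ (proj₂ (proj₂ (proj₂ (sunflower v P 2≤∣_∣)))) A∈ v∈A
    with w∈A , w∈U ← x∈p∩q⁻ A (U v) w∈
    = (v , w) , back (v∈L w) w∈A (λ { refl → v∉U v w∈U }) ([]=⇒lookup w∈U) , sub
    where
    sub : pair (v , w) ⊆ A
    sub x∈ with ∈-pair (v , w) x∈
    ... | inj₁ refl = v∈A
    ... | inj₂ refl = w∈A
  touches : Fin n → Edge n → ℕ
  touches x e = proj₁ e == x + proj₂ e == x
  touches-pos : ∀ {x} e → x ∈ pair e → 1 ≤ touches x e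
  touches-pos {x} e x∈ with ∈-pair e x∈
  ... | inj₁ refl rewrite ==-refl x = s≤s z≤n
  ... | inj₂ refl rewrite ==-refl x = m≤n+m 1 _
  -- An odd intersection is nonempty, and a common point is an end of both edges.
  conflict≤ : ∀ e e′ → 𝟙 (conflict e e′) ≤ touches (proj₁ e) e′ + touches (proj₂ e) e′
  conflict≤ e e′ = 𝟙-does≤ (Odd? ∣ pair e ∩ pair e′ ∣) common
    where
    common : Odd ∣ pair e ∩ pair e′ ∣ → 1 ≤ touches (proj₁ e) e′ + touches (proj₂ e) e′
    common odd with nonempty? (pair e ∩ pair e′)
    ... | no empty = contradiction (subst Odd (Empty⇒∣p∣≡0 empty) odd) λ ()
    ... | yes (x , x∈) with x∈p∩q⁻ (pair e) (pair e′) x∈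
    ...   | x∈e , x∈e′ with ∈-pair e x∈e
    ...     | inj₁ refl = ≤-trans (touches-pos e′ x∈e′) (m≤m+n _ _)
    ...     | inj₂ refl = ≤-trans (touches-pos e′ x∈e′) (m≤n+m _ (touches (proj₁ e) e′))
  -- At most `2 * Δ` back edges touch a point, so an edge has at most `4 * Δ`, that is `4 * k * m`,
  -- conflicts. The extra `m` is positive and makes the bound strict.
  K = (1 + 4 * k) * m
  0<m : 0 < m
  0<m = noClique [] [] []
  few : ∀ e → ∑ (𝟙 ∘ conflict e) Es < K
  few e = begin-strict
    ∑ (𝟙 ∘ conflict e) Es ≤⟨ ∑-mono (conflict≤ e) Es ⟩
    ∑ (λ e′ → touches (proj₁ e) e′ + touches (proj₂ e) e′) Es ≡⟨ ∑-+ _ _ Es ⟩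
    ∑ (touches (proj₁ e)) Es + ∑ (touches (proj₂ e)) Es ≤⟨ +-mono-≤ (degree≤ _ oL uL) (degree≤ _ oL uL) ⟩
    (Δ + Δ) + (Δ + Δ) <⟨ +-monoˡ-< _ 0<m ⟩
    m + ((Δ + Δ) + (Δ + Δ))
      ≡⟨ solve 2 (λ m k → m :+ ((m :* k :+ m :* k) :+ (m :* k :+ m :* k))
                            := (con 1 :+ con 4 :* k) :* m) refl m k ⟩
    K ∎
    where
    open ≤-Reasoning
    open +-*-Solver
  0<K : 0 < K
  0<K = *-mono-≤ {1} {1 + 4 * k} (s≤s z≤n) 0<m
  colouring = greedyColouring (≡-dec Fin._≟_ Fin._≟_) conflict conflict-sym 0<K Es (λ {e} _ → few e)
  proper : ∀ {e e′} → e List.∈ Es → e′ List.∈ Es → proj₁ colouring e ≡ proj₁ colouring e′ →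
    ¬ OddMeet (pair e) (pair e′)
  proper {e} {e′} e∈ e′∈ same odd = apart (≡-dec Fin._≟_ Fin._≟_ e e′)
    where
    apart : ¬ Dec (e ≡ e′)
    apart (yes refl) =
      -- An edge meets itself in two points, an even number, so equal edges are harmless.
      contradiction (subst Odd (trans (cong ∣_∣ (∩-idem (pair e))) (size e∈)) odd) λ ()
    apart (no e≢e′)  = proj₂ colouring e∈ e′∈ e≢e′ (dec-true (Odd? ∣ pair e ∩ pair e′ ∣) odd) same

-- The random reduction

length-concatMap : (g : A → List B) → ∀ t → (∀ x → length (g x) ≡ t) → ∀ xs →
  length (concatMap g xs) ≡ length xs * t
length-concatMap g t eq []       = refl
length-concatMap g t eq (x ∷ xs) =
  trans (length-++ (g x)) (cong₂ _+_ (eq x) (length-concatMap g t eq xs))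

-- `I` is a predicate on all subsets, so it can be pulled back along `A ↦ A ─ S` by composition. The
-- case where `A` and `B` coincide is included; it is consistent because the sets concerned have
-- even size.
Independent : List (Subset n) → (Subset n → Bool) → Set
Independent P I = ∀ {A B} → A List.∈ P → B List.∈ P → I A ≡ true → I B ≡ true → ¬ OddMeet A B

-- T independent sets, with repetitions allowed, together cover each member at least T / s times.
record Cover (P : List (Subset n)) (T s : ℕ) : Set where
  field
    classes     : List (Subset n → Bool)
    count       : length classes ≡ T
    independent : All (Independent P) classes
    covers      : ∀ {A} → A List.∈ P → T ≤ ∑ (λ I → 𝟙 (I A)) classes * s

module Reduction {n k K T s : ℕ} (P : List (Subset n)) (EC : EdgeColouring P K)
  (uniform : ∀ {A} → A List.∈ P → ∣ A ∣ ≡ k) where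
  open EdgeColouring EC

  Kept : Fin K → Subset n → Subset n → Set
  Kept c S A = Any (λ e → colour e ≡ c × A ∩ S ≡ pair e) edges

  kept? : ∀ c S A → Dec (Kept c S A)
  kept? c S A = any? (λ e → (colour e Fin.≟ c) ×-dec Vec.≡-dec Bool._≟_ (A ∩ S) (pair e)) edges

  reduced : Fin K → Subset n → List (Subset n)
  reduced c S = map (_─ S) (filter (kept? c S) P)

  ∈-reduced : ∀ {c S A} → A List.∈ P → Kept c S A → A ─ S List.∈ reduced c S
  ∈-reduced {c} {S} A∈ kept = ∈-map⁺ (_─ S) (∈-filter⁺ (kept? c S) A∈ kept)

  -- Both traces on `S` are pairs of edges of the same colour `c`, so `proper` applies.
  kept-even : ∀ {c S A B} → Kept c S A → Kept c S B → ¬ Odd ∣ (A ∩ S) ∩ (B ∩ S) ∣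
  kept-even keptA keptB odd
    with e  , e∈  , ce  , A∩S ← find keptA
    with e′ , e′∈ , ce′ , B∩S ← find keptB =
    proper e∈ e′∈ (trans ce (sym ce′)) (subst Odd (cong₂ (λ X Y → ∣ X ∩ Y ∣) A∩S B∩S) odd)

  -- The part of the intersection inside `S` is even, so the part outside carries the parity. This
  -- direction pulls independent sets back; the converse below lifts cliques.
  kept⇒OddMeet-─ : ∀ {c S A B} → Kept c S A → Kept c S B → OddMeet A B → OddMeet (A ─ S) (B ─ S)
  kept⇒OddMeet-─ {S = S} {A} {B} keptA keptB odd =
    Odd-+-cancelˡ ∣ (A ∩ S) ∩ (B ∩ S) ∣ (kept-even keptA keptB) (subst Odd (∣p∩q∣-split A B S) odd)

  kept⇒OddMeet : ∀ {c S A B} → Kept c S A → Kept c S B → OddMeet (A ─ S) (B ─ S) → OddMeet A B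
  kept⇒OddMeet {S = S} {A} {B} keptA keptB odd =
    subst Odd (sym (∣p∩q∣-split A B S)) (Odd-+ˡ ∣ (A ∩ S) ∩ (B ∩ S) ∣ (kept-even keptA keptB) odd)

  ∣A─S∣ : ∀ {c S A} → A List.∈ P → Kept c S A → 2 + ∣ A ─ S ∣ ≡ k
  ∣A─S∣ {S = S} {A} A∈ keptA with e , e∈ , _ , A∩S ← find keptA = begin
    2 + ∣ A ─ S ∣         ≡⟨ cong (_+ ∣ A ─ S ∣) (sym (trans (cong ∣_∣ A∩S) (size-2 e∈))) ⟩
    ∣ A ∩ S ∣ + ∣ A ─ S ∣ ≡⟨ ∣p∩q∣+∣p─q∣ A S ⟩
    ∣ A ∣                 ≡⟨ uniform A∈ ⟩
    k                     ∎ where open ≡-Reasoning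

  reduced-uniform : ∀ {c S B} → B List.∈ reduced c S → 2 + ∣ B ∣ ≡ k
  reduced-uniform {c} {S} B∈ with A , A∈ , refl ← ∈-map⁻ (_─ S) B∈
    with A∈P , kept ← ∈-filter⁻ (kept? c S) {xs = P} A∈ = ∣A─S∣ A∈P kept

  -- Preimages are chosen entry by entry. The lifted clique has the same length even where
  -- `A ↦ A ─ S` is not injective on kept members.
  liftClique : ∀ {c S} xs → All (List._∈ reduced c S) xs → AllPairs OddMeet xs →
    ∃ λ ys → map (_─ S) ys ≡ xs × All (List._∈ P) ys × All (Kept c S) ys × AllPairs OddMeet ys
  liftClique [] [] [] = [] , refl , [] , [] , []
  liftClique {c} {S} (x ∷ xs) (x∈ ∷ xs∈) (odd ∷ odds)
    with ys , refl , ys∈ , kepts , oddys ← liftClique xs xs∈ odds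
    with A , A∈ , refl ← ∈-map⁻ (_─ S) x∈
    with A∈P , kept ← ∈-filter⁻ (kept? c S) {xs = P} A∈ =
    A ∷ ys , refl , A∈P ∷ ys∈ , kept ∷ kepts ,
    All.zipWith (λ (keptB , o) → kept⇒OddMeet kept keptB o) (kepts , All.map⁻ odd) ∷ oddys

  reduced-noClique : NoClique m P → ∀ c S → NoClique m (reduced c S)
  reduced-noClique noClique c S xs xs∈ odd with ys , refl , ys∈ , _ , oddys ← liftClique xs xs∈ odd =
    subst (_< _) (sym (length-map (_─ S) ys)) (noClique ys ys∈ oddys)

  pullback : Fin K → Subset n → (Subset n → Bool) → Subset n → Bool
  pullback c S I A = does (kept? c S A) ∧ I (A ─ S)

  pullback-true : ∀ {c S I A} → pullback c S I A ≡ true → Kept c S A × I (A ─ S) ≡ true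
  pullback-true {c} {S} {I} {A} eq with kept? c S A
  ... | yes kept = kept , eq
  ... | no _ with () ← eq

  pullback-independent : ∀ {c S I} → Independent (reduced c S) I → Independent P (pullback c S I)
  pullback-independent {c} {S} {I} ind {A} {B} A∈ B∈ IA IB odd
    with keptA , IA′ ← pullback-true {c} {S} {I} {A} IA
    with keptB , IB′ ← pullback-true {c} {S} {I} {B} IB =
    ind (∈-reduced A∈ keptA) (∈-reduced B∈ keptB) IA′ IB′ (kept⇒OddMeet-─ keptA keptB odd)

  module _ (rec : ∀ c S → Cover (reduced c S) T s) where
    block : Fin K → Subset n → List (Subset n → Bool)
    block c S = map (pullback c S) (Cover.classes (rec c S))

    blocks : Fin K → List (Subset n → Bool)
    blocks c = concatMap (block c) (subsets n)

    block-covers : ∀ {c S A} → A List.∈ P → Kept c S A → T ≤ ∑ (λ I → 𝟙 (I A)) (block c S) * s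
    block-covers {c} {S} {A} A∈ kept = ≤-trans (Cover.covers (rec c S) (∈-reduced A∈ kept))
      (*-monoˡ-≤ s (≤-reflexive (sym (trans (∑-map (λ I → 𝟙 (I A)) (pullback c S) Is)
        (∑-cong (λ I → cong (λ b → 𝟙 (b ∧ I (A ─ S))) (dec-true (kept? c S A) kept)) Is)))))
      where Is = Cover.classes (rec c S)

    -- Fix one edge inside `A`. Among the blocks of its colour, a share of one in `2 ^ k` of the
    -- sets `S` cuts `A` exactly in that edge, and there the recursive cover counts. All other
    -- colours are discarded.
    blocks-cover : ∀ {A} → A List.∈ P →
      2 ^ n * T ≤ 2 ^ k * (∑ (λ I → 𝟙 (I A)) (concatMap blocks (allFin K)) * s)
    blocks-cover {A} A∈ with e , e∈ , e⊆A ← inside-members A∈ = begin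
      2 ^ n * T ≤⟨ ∑-subsets-≥ A (pair e) e⊆A (λ S → hits (block c S) * s) T
                     (λ S A∩S → block-covers A∈ (lose e∈ (refl , A∩S))) ⟩
      2 ^ ∣ A ∣ * ∑ (λ S → hits (block c S) * s) (subsets n)
        ≡⟨ cong₂ (λ i x → 2 ^ i * x) (uniform A∈) (∑-*ʳ (hits ∘ block c) s (subsets n)) ⟩
      2 ^ k * (∑ (hits ∘ block c) (subsets n) * s)
        ≡⟨ cong (λ x → 2 ^ k * (x * s)) (sym (∑-concatMap _ (block c) (subsets n))) ⟩
      2 ^ k * (hits (blocks c) * s)
        ≤⟨ *-monoʳ-≤ (2 ^ k) (*-monoˡ-≤ s (∑-∈ (hits ∘ blocks) (∈-allFin c))) ⟩
      2 ^ k * (∑ (hits ∘ blocks) (allFin K) * s)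
        ≡⟨ cong (λ x → 2 ^ k * (x * s)) (sym (∑-concatMap _ blocks (allFin K))) ⟩
      2 ^ k * (hits (concatMap blocks (allFin K)) * s) ∎
      where
      open ≤-Reasoning
      c = colour e
      hits : List (Subset n → Bool) → ℕ
      hits = ∑ (λ I → 𝟙 (I A))

    cover : Cover P (K * (2 ^ n * T)) (K * (2 ^ k * s))
    cover = record
      { classes     = concatMap blocks (allFin K)
      ; count       = trans (length-concatMap blocks (2 ^ n * T) length-blocks (allFin K))
                        (cong (_* (2 ^ n * T)) (length-tabulate (id {A = Fin K})))
      ; independent = All.concat⁺ (All.map⁺ (All.universal blocks-independent (allFin K)))
      -- Only one of the `K` colours is guaranteed to help, so the size grows by `K` on top of
      -- `2 ^ k`.
      ; covers      = λ {A} A∈ → ≤-trans (*-monoʳ-≤ K (blocks-cover A∈))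
                        (≤-reflexive (rearrange K (2 ^ k) (∑ (λ I → 𝟙 (I A)) (concatMap blocks (allFin K))) s))
      }
      where
      blocks-independent : ∀ c → All (Independent P) (blocks c)
      blocks-independent c = All.concat⁺ (All.map⁺ (All.universal
        (λ S → All.map⁺ (All.map pullback-independent (Cover.independent (rec c S)))) (subsets n)))
      length-blocks : ∀ c → length (blocks c) ≡ 2 ^ n * T
      length-blocks c = trans (length-concatMap (block c) T
        (λ S → trans (length-map (pullback c S) (Cover.classes (rec c S))) (Cover.count (rec c S)))
        (subsets n))
        (cong (_* T) (length-subsets n))
      rearrange : ∀ K p x s → K * (p * (x * s)) ≡ x * (K * (p * s))
      rearrange = solve 4 (λ K p x s → K :* (p :* (x :* s)) := x :* (K :* (p :* s))) refl
        where open +-*-Solver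

-- Constants and the induction on half the set size

colours : ℕ → ℕ
colours j = 1 + 4 * (2 * suc j)

-- The number of independent sets listed: each level multiplies it by the number of choices of a
-- colour and of `S`. Its dependence on `n` disappears on normalising.
total : ℕ → ℕ → ℕ → ℕ
total n m zero    = 1
total n m (suc j) = colours j * m * (2 ^ n * total n m j)

-- The loss per level is `K * 2 ^ k` with `k` equal to `2 * suc j` and `K` to `colours j * m`; the
-- factors `m` are collected separately into `m ^ j`.
constant : ℕ → ℕ
constant zero    = 1
constant (suc j) = colours j * (2 ^ (2 * suc j) * constant j)

evenCover : ∀ j (P : List (Subset n)) → (∀ {A} → A List.∈ P → ∣ A ∣ ≡ 2 * j) → NoClique m P →
  Cover P (total n m j) (constant j * m ^ j)
evenCover zero P uniform noClique = record
  { classes     = (λ _ → true) ∷ []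
  ; count       = refl
  -- All members are empty here, so the single class containing everything is independent.
  ; independent = (λ {A} {B} A∈ _ _ _ →
      ¬Odd-≤0 (subst (∣ A ∩ B ∣ ≤_) (uniform A∈) (∣p∩q∣≤∣p∣ A B))) ∷ []
  ; covers      = λ _ → ≤-refl
  }
  where
  ¬Odd-≤0 : ∀ {a} → a ≤ 0 → ¬ Odd a
  ¬Odd-≤0 z≤n ()
evenCover {n} {m} (suc j) P uniform noClique =
  subst (Cover P (total n m (suc j)))
    (rearrange (colours j) m (2 ^ (2 * suc j)) (constant j) (m ^ j))
    (cover λ c S → evenCover j (reduced c S)
      (λ B∈ → +-cancelˡ-≡ 2 _ _ (trans (reduced-uniform B∈) (*-suc 2 j)))
      (reduced-noClique noClique c S))
  where
  open Reduction P (edgeColouring (2 * suc j) m P (*-monoʳ-≤ 2 (s≤s (z≤n {j}))) uniform noClique) uniform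
  rearrange : ∀ c m p d q → c * m * (p * (d * q)) ≡ c * (p * d) * (m * q)
  rearrange = solve 5 (λ c m p d q → c :* m :* (p :* (d :* q)) := c :* (p :* d) :* (m :* q)) refl
    where open +-*-Solver

-- Rational weights

-- Opened only here, as its prefix +_ is ambiguous with sections of addition on ℕ.
open import Data.Integer using (+_)

fromℕ : ℕ → ℚ
fromℕ a = + a / 1

toℚᵘ-fromℕ : ∀ a → toℚᵘ (fromℕ a) ℚᵘ.≃ ℚᵘ.mkℚᵘ (+ a) 0
toℚᵘ-fromℕ a = ℚ.toℚᵘ-fromℚᵘ (ℚᵘ.mkℚᵘ (+ a) 0)

fromℕ-+ : ∀ a b → fromℕ (a + b) ≡ fromℕ a ℚ.+ fromℕ b
fromℕ-+ a b = ℚ.toℚᵘ-injective (begin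
  toℚᵘ (fromℕ (a + b))                        ≈⟨ toℚᵘ-fromℕ (a + b) ⟩
  ℚᵘ.mkℚᵘ (+ (a + b)) 0                       ≈⟨ ℚᵘ.*≡* (cong (ℤ._* + 1) (sym
    (cong₂ ℤ._+_ (ℤ.*-identityʳ (+ a)) (ℤ.*-identityʳ (+ b))))) ⟩
  ℚᵘ.mkℚᵘ (+ a) 0 ℚᵘ.+ ℚᵘ.mkℚᵘ (+ b) 0        ≈⟨ ℚᵘ.+-cong (toℚᵘ-fromℕ a) (toℚᵘ-fromℕ b) ⟨
  toℚᵘ (fromℕ a) ℚᵘ.+ toℚᵘ (fromℕ b)          ≈⟨ ℚ.toℚᵘ-homo-+ (fromℕ a) (fromℕ b) ⟨
  toℚᵘ (fromℕ a ℚ.+ fromℕ b)                  ∎)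
  where open ℚᵘ.≃-Reasoning

fromℕ-* : ∀ a b → fromℕ (a * b) ≡ fromℕ a ℚ.* fromℕ b
fromℕ-* a b = ℚ.toℚᵘ-injective (begin
  toℚᵘ (fromℕ (a * b))                        ≈⟨ toℚᵘ-fromℕ (a * b) ⟩
  ℚᵘ.mkℚᵘ (+ (a * b)) 0                       ≈⟨ ℚᵘ.*≡* (cong (ℤ._* + 1) (ℤ.pos-* a b)) ⟩
  ℚᵘ.mkℚᵘ (+ a) 0 ℚᵘ.* ℚᵘ.mkℚᵘ (+ b) 0        ≈⟨ ℚᵘ.*-cong (toℚᵘ-fromℕ a) (toℚᵘ-fromℕ b) ⟨
  toℚᵘ (fromℕ a) ℚᵘ.* toℚᵘ (fromℕ b)          ≈⟨ ℚ.toℚᵘ-homo-* (fromℕ a) (fromℕ b) ⟨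
  toℚᵘ (fromℕ a ℚ.* fromℕ b)                  ∎)
  where open ℚᵘ.≃-Reasoning

fromℕ-mono-≤ : ∀ {a b} → a ≤ b → fromℕ a ℚ.≤ fromℕ b
fromℕ-mono-≤ {a} {b} a≤b = ℚ.toℚᵘ-cancel-≤ (begin
  toℚᵘ (fromℕ a)  ≃⟨ toℚᵘ-fromℕ a ⟩
  ℚᵘ.mkℚᵘ (+ a) 0 ≤⟨ ℚᵘ.*≤* (ℤ.*-monoʳ-≤-nonNeg (+ 1) (ℤ.+≤+ a≤b)) ⟩
  ℚᵘ.mkℚᵘ (+ b) 0 ≃⟨ toℚᵘ-fromℕ b ⟨
  toℚᵘ (fromℕ b)  ∎)
  where open ℚᵘ.≤-Reasoning

1/_ : ∀ T .{{_ : ℕ.NonZero T}} → ℚ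
1/ T = + 1 / T

1/-nonNeg : ∀ T .{{_ : ℕ.NonZero T}} → ℚ.NonNegative (1/ T)
1/-nonNeg T = ℚ.normalize-nonNeg 1 T

fromℕ-*-1/ : ∀ T .{{_ : ℕ.NonZero T}} → fromℕ T ℚ.* (1/ T) ≡ 1ℚ
fromℕ-*-1/ (suc t) = ℚ.toℚᵘ-injective (begin
  toℚᵘ (fromℕ (suc t) ℚ.* (1/ suc t))           ≈⟨ ℚ.toℚᵘ-homo-* (fromℕ (suc t)) (1/ suc t) ⟩
  toℚᵘ (fromℕ (suc t)) ℚᵘ.* toℚᵘ (1/ suc t)     ≈⟨ ℚᵘ.*-cong (toℚᵘ-fromℕ (suc t))
    (ℚ.toℚᵘ-fromℚᵘ (ℚᵘ.mkℚᵘ (+ 1) t)) ⟩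
  ℚᵘ.mkℚᵘ (+ suc t) 0 ℚᵘ.* ℚᵘ.mkℚᵘ (+ 1) t      ≈⟨ ℚᵘ.*≡* (cong (+_ ∘ suc) (trans (*-identityʳ _)
    (trans (*-identityʳ t) (trans (sym (+-identityʳ t)) (sym (+-identityʳ _)))))) ⟩
  toℚᵘ 1ℚ                                       ∎)
  where open ℚᵘ.≃-Reasoning

fromℕ-suc-* : ∀ a w → w ℚ.+ fromℕ a ℚ.* w ≡ fromℕ (suc a) ℚ.* w
fromℕ-suc-* a w = begin
  w ℚ.+ fromℕ a ℚ.* w        ≡⟨ cong (ℚ._+ fromℕ a ℚ.* w) (sym (ℚ.*-identityˡ w)) ⟩
  1ℚ ℚ.* w ℚ.+ fromℕ a ℚ.* w ≡⟨ sym (ℚ.*-distribʳ-+ w 1ℚ (fromℕ a)) ⟩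
  (1ℚ ℚ.+ fromℕ a) ℚ.* w     ≡⟨ cong (ℚ._* w) (sym (fromℕ-+ 1 a)) ⟩
  fromℕ (suc a) ℚ.* w        ∎ where open ≡-Reasoning

uniformly : ℚ → List (Subset n) → WeightedSets n
uniformly w = map (w ,_)

totalWeight-uniformly : ∀ w (Is : List (Subset n)) →
  totalWeight (uniformly w Is) ≡ fromℕ (length Is) ℚ.* w
totalWeight-uniformly w []       = sym (ℚ.*-zeroˡ w)
totalWeight-uniformly w (I ∷ Is) =
  trans (cong (w ℚ.+_) (totalWeight-uniformly w Is)) (fromℕ-suc-* (length Is) w)

massAt-uniformly : ∀ w (Is : List (Subset n)) v →
  massAt (uniformly w Is) v ≡ fromℕ (∑ (λ I → 𝟙 (lookup I v)) Is) ℚ.* w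
massAt-uniformly w []       v = sym (ℚ.*-zeroˡ w)
massAt-uniformly w (I ∷ Is) v with lookup I v
... | true  = trans (cong (w ℚ.+_) (massAt-uniformly w Is v))
  (fromℕ-suc-* (∑ (λ I → 𝟙 (lookup I v)) Is) w)
... | false = trans (ℚ.+-identityˡ _) (massAt-uniformly w Is v)

-- Passing between families and lists, and the final bound

AllPairs-lookup : ∀ {R : A → A → Set} {xs} → AllPairs R xs → ∀ i j → i Fin.< j →
  R (List.lookup xs i) (List.lookup xs j)
AllPairs-lookup {xs = _ ∷ xs} (Rx ∷ _) Fin.zero (Fin.suc j) _ = All.lookup Rx (∈-lookup {xs = xs} j)
AllPairs-lookup (_ ∷ Rs) (Fin.suc i) (Fin.suc j) (s≤s i<j) = AllPairs-lookup Rs i j i<j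

¬Odd-double : ∀ j → ¬ Odd (2 * j)
¬Odd-double j odd =
  contradiction (trans (sym odd) (trans (cong (_% 2) (*-comm 2 j)) (m*n%n≡0 j 2))) λ ()

-- The first `m` entries of a longer list clique serve as vertices. They are distinct because a
-- repeated vertex would be adjacent to itself, while its set has even size.
noLClique⇒NoClique : ∀ {n m j} (𝓕 : Family n (2 * j)) → ¬ HasLClique 𝓕 m → NoClique m (sets 𝓕)
noLClique⇒NoClique {n} {m} {j} 𝓕 noHL xs xs∈ odds =
  ≰⇒> λ m≤ → noHL (vertex m≤ , injective m≤ , adjacent m≤)
  where
  module _ (m≤ : m ≤ length xs) where
    position : Fin m → Fin (length xs)
    position i = Fin.inject≤ i m≤
    occurs : ∀ i → List.lookup xs (position i) List.∈ sets 𝓕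
    occurs i = All.lookup xs∈ (∈-lookup {xs = xs} (position i))
    vertex : Fin m → Vertex 𝓕
    vertex i = index (occurs i)
    adjacent : ∀ i j → i Fin.< j → Adj 𝓕 (vertex i) (vertex j)
    adjacent i j i<j = subst₂ OddMeet (lookup-index (occurs i)) (lookup-index (occurs j))
      (AllPairs-lookup odds (position i) (position j)
        (subst₂ _<_ (sym (Fin.toℕ-inject≤ i m≤)) (sym (Fin.toℕ-inject≤ j m≤)) i<j))
    irreflexive : ∀ v → ¬ Adj 𝓕 v v
    irreflexive v odd = ¬Odd-double j (subst Odd
      (trans (cong ∣_∣ (∩-idem (member 𝓕 v))) (uniform 𝓕 (∈-lookup {xs = sets 𝓕} v))) odd)
    injective : ∀ {i j} → vertex i ≡ vertex j → i ≡ j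
    injective {i} {j} eq with Fin.<-cmp i j
    ... | tri< i<j _ _ = contradiction (subst (Adj 𝓕 _) (sym eq) (adjacent i j i<j)) (irreflexive _)
    ... | tri≈ _ i≡j _ = i≡j
    ... | tri> _ _ j<i = contradiction (subst (Adj 𝓕 _) eq (adjacent j i j<i)) (irreflexive _)

total≢0 : ∀ n m j → .{{ℕ.NonZero m}} → ℕ.NonZero (total n m j)
total≢0 n m zero    = _
total≢0 n m (suc j) = m*n≢0 (colours j * m) (2 ^ n * total n m j)
  where instance
  _ = m*n≢0 (colours j) m
  _ = m^n≢0 2 n
  _ = total≢0 n m j
  _ = m*n≢0 (2 ^ n) (total n m j)

constant≢0 : ∀ j → ℕ.NonZero (constant j)
constant≢0 zero    = _
constant≢0 (suc j) = m*n≢0 (colours j) (2 ^ (2 * suc j) * constant j)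
  where instance
  _ = m^n≢0 2 (2 * suc j)
  _ = constant≢0 j
  _ = m*n≢0 (2 ^ (2 * suc j)) (constant j)

-- The uniform distribution on the `T` listed classes: dividing the covering inequality by `T` gives
-- the bound on probabilities.
fractionalColouring : ∀ {n k} (𝓕 : Family n k) T s → .{{ℕ.NonZero T}} → 1 ≤ s →
  Cover (sets 𝓕) T s → FractionalColouring 𝓕 (fromℕ s)
fractionalColouring {n} 𝓕 T s 1≤s C = record
  { size≥1      = fromℕ-mono-≤ 1≤s
  ; dist        = uniformly (1/ T) (map restrict classes)
  ; nonneg      = All.map⁺ (All.universal (λ _ → ℚ.nonNegative⁻¹ (1/ T)) _)
  ; independent = All.map⁺ (All.map⁺ (All.map restrict-independent independent))
  ; sums-to-1   = trans (totalWeight-uniformly (1/ T) (map restrict classes))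
                    (trans (cong (λ i → fromℕ i ℚ.* (1/ T)) (trans (length-map restrict classes) count))
                      (fromℕ-*-1/ T))
  ; covers      = λ v → subst (1ℚ ℚ.≤_)
                    (cong (fromℕ s ℚ.*_) (sym (massAt-uniformly (1/ T) (map restrict classes) v))) (mass v)
  }
  where
  open Cover C
  instance _ = 1/-nonNeg T
  restrict : (Subset n → Bool) → Subset (length (sets 𝓕))
  restrict I = Vec.tabulate (I ∘ member 𝓕)
  lookup-restrict : ∀ I v → lookup (restrict I) v ≡ I (member 𝓕 v)
  lookup-restrict I = Vec.lookup∘tabulate (I ∘ member 𝓕)
  restrict-independent : ∀ {I} → Independent (sets 𝓕) I → IsIndependent 𝓕 (restrict I)
  restrict-independent {I} ind u v _ u∈I v∈I =
    ind (∈-lookup {xs = sets 𝓕} u) (∈-lookup {xs = sets 𝓕} v)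
    (trans (sym (lookup-restrict I u)) u∈I) (trans (sym (lookup-restrict I v)) v∈I)
  mass : ∀ v → 1ℚ ℚ.≤ fromℕ s ℚ.* (fromℕ (∑ (λ I → 𝟙 (lookup I v)) (map restrict classes)) ℚ.* (1/ T))
  mass v = begin
    1ℚ                                    ≡⟨ sym (fromℕ-*-1/ T) ⟩
    fromℕ T ℚ.* (1/ T)                    ≤⟨ ℚ.*-monoʳ-≤-nonNeg (1/ T) (fromℕ-mono-≤
      (≤-trans (covers (∈-lookup {xs = sets 𝓕} v)) (≤-reflexive same))) ⟩
    fromℕ (s * hits) ℚ.* (1/ T)           ≡⟨ cong (ℚ._* (1/ T)) (fromℕ-* s hits) ⟩
    fromℕ s ℚ.* fromℕ hits ℚ.* (1/ T)     ≡⟨ ℚ.*-assoc (fromℕ s) (fromℕ hits) (1/ T) ⟩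
    fromℕ s ℚ.* (fromℕ hits ℚ.* (1/ T))   ∎
    where
    open ℚ.≤-Reasoning
    hits = ∑ (λ I → 𝟙 (lookup I v)) (map restrict classes)
    same : ∑ (λ I → 𝟙 (I (member 𝓕 v))) classes * s ≡ s * hits
    same = trans (*-comm _ s) (cong (s *_) (sym (trans (∑-map (λ I → 𝟙 (lookup I v)) restrict classes)
      (∑-cong (λ I → cong 𝟙 (lookup-restrict I v)) classes))))

theorem5p5 : (j : ℕ) → Σ ℕ λ C → (n m : ℕ) (𝓕 : Family n (2 * suc j)) →
    ¬ HasLClique 𝓕 m → FracChromaticAtMost 𝓕 (+ (C * m ^ suc j) / 1)
theorem5p5 j = constant (suc j) , bound
  where
  bound : (n m : ℕ) (𝓕 : Family n (2 * suc j)) → ¬ HasLClique 𝓕 m →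
    FracChromaticAtMost 𝓕 (+ (constant (suc j) * m ^ suc j) / 1)
  bound n m 𝓕 noHL = _ , ℚ.≤-refl ,
    fractionalColouring 𝓕 (total n m (suc j)) (constant (suc j) * m ^ suc j) {{total≢0 n m (suc j)}}
      (*-mono-≤ (ℕ.>-nonZero⁻¹ _ {{constant≢0 (suc j)}}) (ℕ.>-nonZero⁻¹ _ {{m^n≢0 m (suc j)}}))
      (evenCover (suc j) (sets 𝓕) (uniform 𝓕) noClique)
    where
    noClique = noLClique⇒NoClique {j = suc j} 𝓕 noHL
    -- The empty clique rules out `m` being 0; hence `total` is nonzero and the size is at least 1.
    instance _ = ℕ.>-nonZero (noClique [] [] [])
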